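{- (Cayley's Completeness Theorem for quantifier theories.) Let $\mathbf A$ be a locally finite quantifier theory over $\mathcal S$ and let $Z\in\mathcal S$ be an infinite set. Then the modification $\mathbf A[Z]$ of $\mathbf A$ by $Z$ is a faithful quantifier model of $\mathbf A$.
   Context: Throughout, $\mathcal S$ is a nonempty collection of sets containing at least one infinite set; $X,Y,Z,W$ denote members of $\mathcal S$ (sets of variables). Quantifier theory. A quantifier theory $\mathbf A$ over $\mathcal S$ consists of: a set $\mathbf A^*(X)$ and a map $\epsilon_X:X\to\mathbf A^*(X)$ for each $X$ (one writes $x$ for $\epsilon_X(x)$); a Boolean algebra $\mathbf A_*(X)$ for each $X$; an element $a\sigma\in\mathbf A^*(Y)$ for each nonempty $X$, $a\in\mathbf A^*(X)$ and map $\sigma:X\to\mathbf A^*(Y)$; an element $p\sigma\in\mathbf A_*(Y)$ for each nonempty $X$, $p\in\mathbf A_*(X)$ and map $\sigma:X\to\mathbf A^*(Y)$; an element $\forall x.p\in\mathbf A_*(X)$ for each nonempty $X$, $x\in X$, $p\in\mathbf A_*(X)$. Put $\mathbf A(X)=\mathbf A_*(X)\cup\mathbf A^*(X)$. For all nonempty $X$, $x\in X$, $t\in\mathbf A(X)$, $\sigma:X\to\mathbf A^*(Y)$, $p,q\in\mathbf A_*(X)$ the following hold. (P1) $t\epsilon_X=t$. (P2) $(t\sigma)\tau=t(\sigma\tau)$ if $Y$ is nonempty and $\tau:Y\to\mathbf A^*(W)$, where $(\sigma\tau)(x)=\sigma(x)\tau$. (P3) $x\sigma=\sigma(x)$. (P4)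 $p\mapsto p\sigma$ is a homomorphism of Boolean algebras $\mathbf A_*(X)\to\mathbf A_*(Y)$. (P5) $(\forall x.p)\sigma=\forall y.(p\sigma^{y/x})$ whenever $y,z\in Y$, $y\ne z$ and $\sigma[z/y]=\sigma$. (Q1) $\forall x.(p\wedge q)=\forall x.p\wedge\forall x.q$. (Q2) $\forall x.p\le p$. (Q3) $\forall x.p=p$ if $p[y/x]=p$ for some $y\in X$, $y\neq x$. Notation: for $y\in Y$ and $d\in\mathbf A^*(Y)$, $[d/y]:Y\to\mathbf A^*(Y)$ sends $y$ to $d$ and every other variable to itself; for $d\in \mathbf A^*(Y)$, $\sigma^{d/x}:X\to\mathbf A^*(Y)$ sends $x$ to $d$ and agrees with $\sigma$ elsewhere. Supports. For nonempty $X$ and $t\in\mathbf A(X)$, a subset $U\subseteq X$ is a support for $t$ if $t\sigma=t\tau$ for all $Y$ and all $\sigma,\tau:X\to\mathbf A^*(Y)$ with $\sigma|_U=\tau|_U$; $t$ is closed if $\emptyset$ is a support for $t$ (elements of $\mathbf A(\emptyset)$ are by definition closed). $\mathbf A$ is locally finite if every element of every $\mathbf A(X)$ has a finite support. Standing convention: every quantifier theory considered is nontrivial, meaning that $\mathbf A_*(X)$ has a non-closed element for some nonempty $X\in\mathcal S$. Models. A quantifier model is a quantifier theory $\mathbf B$ over a collection containing $\emptyset$ such that (M1) $\mathbf B^*(\emptyset)\neq\emptyset$ and $\mathbf B_*(\emptyset)$ is a nontrivial Boolean algebra ($0\ne1$); (M2) for nonempty $X$, $x\in X$, $p\in\mathbf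 B_*(X)$, $\sigma:X\to\mathbf B^*(\emptyset)$, the infimum $\bigwedge_{d\in\mathbf B^*(\emptyset)}p\sigma^{d/x}$ exists in $\mathbf B_*(\emptyset)$ and equals $(\forall x.p)\sigma$. A modification (resp. model) of a quantifier theory $\mathbf A$ over $\mathcal S$ is a quantifier theory (resp. quantifier model) $\mathbf B$ over $\mathcal S\cup\{\emptyset\}$ whose restriction to $\mathcal S\setminus\{\emptyset\}$ equals that of $\mathbf A$. The modification $\mathbf A[Z]$ (for nonempty $Z\in\mathcal S$): it agrees with $\mathbf A$ on $\mathcal S\setminus\{\emptyset\}$, $\mathbf A[Z]_*(\emptyset)=\mathbf A_*(Z)$, $\mathbf A[Z]^*(\emptyset)=\mathbf A^*(Z)$, and for nonempty $X$, $t\in\mathbf A(X)$ and $\sigma:X\to\mathbf A[Z]^*(\emptyset)=\mathbf A^*(Z)$, the element $t\sigma$ is the one given in $\mathbf A$. Faithful: a theory $\mathbf B$ over a collection containing $\emptyset$ is faithful if $\mathbf B^*(\emptyset)$ is nonempty and, for every nonempty $X$ and $t,s\in\mathbf B(X)$, $t=s$ iff $t\sigma=s\sigma$ for all $\sigma:X\to\mathbf B^*(\emptyset)$ (here $t,s$ are both in $\mathbf B_*(X)$ or both in $\mathbf B^*(X)$). -}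

module Defs where

open import Level using (Level; Setω; _⊔_; lower; suc)
open import Algebra.Lattice.Bundles using (BooleanAlgebra)
open import Algebra.Lattice.Morphism.Structures using (IsLatticeHomomorphism)
import Algebra.Lattice.Properties.Lattice as LatticeProperties
open import Algebra.Morphism.Definitions using (Homomorphic₀; Homomorphic₁)
open import Axiom.ExcludedMiddle using (ExcludedMiddle)
open import Data.Empty using (⊥-elim-irr)
open import Data.Empty.Polymorphic using (⊥)
open import Data.List.Base using (List)
open import Data.List.Membership.Propositional renaming (_∈_ to _∈ₗ_)
open import Data.Maybe.Base using (Maybe; just; nothing; maybe)
open import Data.Product.Base using (∃; _×_; _,_; proj₁)
open import Data.Refinement.Base using (Refinement; value)
open import Function.Base using (_∘_)
open import Function.Bundles using (_⇔_)
open import Relation.Binary.Bundles using (Poset; Setoid)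
open import Relation.Binary.PropositionalEquality.Core using (_≡_; _≢_)
open import Relation.Nullary using (¬_; yes; no)
open import Relation.Unary using (Pred; _∈_; _≐_; U; ∅)

-- The source works in classical set theory.  Excluded middle is an explicit
-- parameter wherever it is needed; already σ^{d/x} is defined by cases on
-- whether two variables are equal.

Classical : Setω
Classical = ∀ {ℓ} → ExcludedMiddle ℓ

Finite : ∀ {a p} {A : Set a} → Pred A p → Set (a ⊔ p)
Finite P = ∃ λ xs → P ≐ (_∈ₗ xs)

Infinite : ∀ {a} → Set a → Set a
Infinite A = ¬ Finite (U {A = A})

------------------------------------------------------------------------
-- Collections of sets, as families

record Collection (i v : Level) : Set (suc (i ⊔ v)) where
  field
    Index : Set i
    Var   : Index → Set v

open Collection public

-- Nonemptiness of a set of variables is rendered as an irrelevant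
-- inhabitant, so that nothing can depend on which inhabitant is supplied.

_∖∅ : ∀ {i v} → Collection i v → Collection (i ⊔ v) v
S ∖∅ = record { Index = Refinement (Index S) (Var S) ; Var = Var S ∘ value }

-- (S ∖ {∅}) ∪ {∅}: if S already has empty members, the new one, `nothing`,
-- takes their place.

_∪∅ : ∀ {i v} → Collection i v → Collection (i ⊔ v) v
S ∪∅ = record { Index = Maybe (Index (S ∖∅)) ; Var = maybe (Var (S ∖∅)) ⊥ }

EmptyMember : ∀ {i v} → Collection i v → Set (i ⊔ v)
EmptyMember S = ∃ λ X → ¬ Var S X

∅ᵐ : ∀ {i v} (S : Collection i v) → EmptyMember (S ∪∅)
∅ᵐ S = nothing , λ ()

------------------------------------------------------------------------
-- Boolean algebras

module _ {c ℓ} (B : BooleanAlgebra c ℓ) where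
  open BooleanAlgebra B using (Carrier; lattice)
  open Poset (LatticeProperties.poset lattice) using (_≤_)

  LessEq : Carrier → Carrier → Set ℓ
  LessEq = _≤_

  IsInfimum : ∀ {d} {D : Set d} → (D → Carrier) → Carrier → Set (c ⊔ ℓ ⊔ d)
  IsInfimum f m = (∀ d → m ≤ f d) × (∀ q → (∀ d → q ≤ f d) → q ≤ m)

module _ {a b ℓ₁ ℓ₂} (B₁ : BooleanAlgebra a ℓ₁) (B₂ : BooleanAlgebra b ℓ₂) where
  private
    module B₁ = BooleanAlgebra B₁
    module B₂ = BooleanAlgebra B₂

  record IsBooleanHomomorphism (f : B₁.Carrier → B₂.Carrier) : Set (a ⊔ b ⊔ ℓ₁ ⊔ ℓ₂) where
    field
      isLatticeHomomorphism : IsLatticeHomomorphism B₁.rawLattice B₂.rawLattice f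
      ¬-homo : Homomorphic₁ B₁.Carrier B₂.Carrier B₂._≈_ f B₁.¬_ B₂.¬_
      ⊤-homo : Homomorphic₀ B₁.Carrier B₂.Carrier B₂._≈_ f B₁.⊤ B₂.⊤
      ⊥-homo : Homomorphic₀ B₁.Carrier B₂.Carrier B₂._≈_ f B₁.⊥ B₂.⊥

------------------------------------------------------------------------
-- Quantifier theories

-- The two parts of A(X) = A_*(X) ∪ A^*(X).

data Sort : Set where
  form term : Sort

-- Form X is A_*(X) and Term X is A^*(X).  Sets are setoids here, as the
-- Boolean algebras of the library already are.

record RawTheory {i v} (S : Collection i v) (c ℓ : Level) : Set (i ⊔ v ⊔ suc (c ⊔ ℓ)) where
  field
    Form : Index S → BooleanAlgebra c ℓ
    Term : Index S → Setoid c ℓ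

  Fm : Index S → Set c
  Fm X = BooleanAlgebra.Carrier (Form X)

  Tm : Index S → Set c
  Tm X = Setoid.Carrier (Term X)

  Subst : Index S → Index S → Set (v ⊔ c)
  Subst X Y = Var S X → Tm Y

  field
    ε       : ∀ {X} → Subst X X
    subForm : ∀ {X Y} → .(Var S X) → Fm X → Subst X Y → Fm Y
    subTerm : ∀ {X Y} → .(Var S X) → Tm X → Subst X Y → Tm Y
    All     : ∀ {X} → Var S X → Fm X → Fm X

  Elem : Sort → Index S → Setoid c ℓ
  Elem form X = BooleanAlgebra.setoid (Form X)
  Elem term X = Term X

  ∣_∣ : Sort → Index S → Set c
  ∣ s ∣ X = Setoid.Carrier (Elem s X)

  infix 4 Equal

  Equal : ∀ s X → ∣ s ∣ X → ∣ s ∣ X → Set ℓ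
  Equal s X = Setoid._≈_ (Elem s X)

  syntax Equal s X t u = t ≈[ s , X ] u

  -- sub s x₀ t σ is tσ, where x₀ witnesses that X is nonempty.

  sub : ∀ s {X Y} → .(Var S X) → ∣ s ∣ X → Subst X Y → ∣ s ∣ Y
  sub form = subForm
  sub term = subTerm

  infix 4 _≋_

  _≋_ : ∀ {X Y} → Subst X Y → Subst X Y → Set (v ⊔ ℓ)
  _≋_ {Y = Y} σ τ = ∀ x → σ x ≈[ term , Y ] τ x

  -- comp y₀ σ τ is στ, in the order of the source: first σ, then τ.

  comp : ∀ {X Y W} → .(Var S Y) → Subst X Y → Subst Y W → Subst X W
  comp y₀ σ τ x = subTerm y₀ (σ x) τ

  IsSupport : ∀ {p} s {X} → Pred (Var S X) p → ∣ s ∣ X → Set (i ⊔ v ⊔ c ⊔ ℓ ⊔ p)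
  IsSupport s {X} V t =
    ∀ {Y} .(x₀ : Var S X) (σ τ : Subst X Y) →
    (∀ {x} → x ∈ V → σ x ≈[ term , Y ] τ x) →
    sub s x₀ t σ ≈[ s , Y ] sub s x₀ t τ

  -- If X is empty, this holds of every element of A(X).

  Closed : ∀ s {X} → ∣ s ∣ X → Set (i ⊔ v ⊔ c ⊔ ℓ)
  Closed s t = IsSupport s ∅ t

  LocallyFinite : Set (i ⊔ suc v ⊔ c ⊔ ℓ)
  LocallyFinite =
    ∀ s {X} (t : ∣ s ∣ X) →
    ∃ λ (V : Pred (Var S X) v) → Finite V × IsSupport s V t

module _ (em : Classical) {i v c ℓ} {S : Collection i v} (A : RawTheory S c ℓ) where
  open RawTheory A

  -- override σ d x is σ^{d/x}, and [ d / y ] is the substitution [d/y].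

  override : ∀ {X Y} → Subst X Y → Tm Y → Var S X → Subst X Y
  override σ d x x′ with em {P = x′ ≡ x}
  ... | yes _ = d
  ... | no  _ = σ x′

  [_/_] : ∀ {Y} → Tm Y → Var S Y → Subst Y Y
  [ d / y ] = override ε d y

  -- The cong fields say that the operations are well defined on the setoids;
  -- for p ↦ pσ this overlaps with P4.  The fields `infinite` and
  -- `nontrivial` are the standing conventions.

  record IsQuantifierTheory : Set (i ⊔ v ⊔ c ⊔ ℓ) where
    field
      infinite   : ∃ λ X → Infinite (Var S X)
      nontrivial : ∃ λ X → Var S X × ∃ λ (p : Fm X) → ¬ Closed form p

      sub-cong : ∀ s {X Y} .(x₀ : Var S X) {t t′ : ∣ s ∣ X} {σ σ′ : Subst X Y} →
        t ≈[ s , X ] t′ → σ ≋ σ′ →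
        sub s x₀ t σ ≈[ s , Y ] sub s x₀ t′ σ′
      All-cong : ∀ {X} (x : Var S X) {p q : Fm X} →
        p ≈[ form , X ] q → All x p ≈[ form , X ] All x q

      P1 : ∀ s {X} .(x₀ : Var S X) (t : ∣ s ∣ X) →
        sub s x₀ t ε ≈[ s , X ] t
      P2 : ∀ s {X Y W} .(x₀ : Var S X) .(y₀ : Var S Y)
        (t : ∣ s ∣ X) (σ : Subst X Y) (τ : Subst Y W) →
        sub s y₀ (sub s x₀ t σ) τ ≈[ s , W ] sub s x₀ t (comp y₀ σ τ)
      P3 : ∀ {X Y} (x : Var S X) (σ : Subst X Y) →
        subTerm x (ε x) σ ≈[ term , Y ] σ x
      P4 : ∀ {X Y} .(x₀ : Var S X) (σ : Subst X Y) →
        IsBooleanHomomorphism (Form X) (Form Y) (λ p → subForm x₀ p σ)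
      P5 : ∀ {X Y} (x : Var S X) (p : Fm X) (σ : Subst X Y) (y z : Var S Y) →
        y ≢ z → comp y σ [ ε z / y ] ≋ σ →
        subForm x (All x p) σ ≈[ form , Y ] All y (subForm x p (override σ (ε y) x))

      Q1 : ∀ {X} (x : Var S X) (p q : Fm X) → let open BooleanAlgebra (Form X) in
        All x (p ∧ q) ≈ All x p ∧ All x q
      Q2 : ∀ {X} (x : Var S X) (p : Fm X) → LessEq (Form X) (All x p) p
      Q3 : ∀ {X} (x : Var S X) (p : Fm X) (y : Var S X) → y ≢ x →
        subForm x p [ ε y / x ] ≈[ form , X ] p →
        All x p ≈[ form , X ] p

  record IsQuantifierModel (e : EmptyMember S) : Set (i ⊔ v ⊔ c ⊔ ℓ) where
    private
      E : Index S
      E = proj₁ e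
    field
      isQuantifierTheory : IsQuantifierTheory
      M1-term : Tm E
      M1-form : let open BooleanAlgebra (Form E) renaming (¬_ to ∁_; ⊥ to 𝟘; ⊤ to 𝟙) in
        ¬ (𝟘 ≈ 𝟙)
      M2 : ∀ {X} (x : Var S X) (p : Fm X) (σ : Subst X E) →
        IsInfimum (Form E) (λ (d : Tm E) → subForm x p (override σ d x))
          (subForm x (All x p) σ)

module _ {i v c ℓ} {S : Collection i v} (B : RawTheory S c ℓ) where
  open RawTheory B

  record IsFaithful (e : EmptyMember S) : Set (i ⊔ v ⊔ c ⊔ ℓ) where
    private
      E : Index S
      E = proj₁ e
    field
      inhabited : Tm E
      separates : ∀ s {X} .(x₀ : Var S X) (t u : ∣ s ∣ X) →
        t ≈[ s , X ] u ⇔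
        (∀ (σ : Subst X E) → sub s x₀ t σ ≈[ s , E ] sub s x₀ u σ)

------------------------------------------------------------------------
-- Modifications and models of a theory

restrict : ∀ {i j v c ℓ} {S : Collection i v} {J : Set j} (f : J → Index S) →
  RawTheory S c ℓ → RawTheory (record { Index = J ; Var = Var S ∘ f }) c ℓ
restrict f A = record
  { Form = Form ∘ f ; Term = Term ∘ f ; ε = ε
  ; subForm = subForm ; subTerm = subTerm ; All = All }
  where open RawTheory A

module _ (em : Classical) {i v c ℓ} {S : Collection i v}
  (A : RawTheory S c ℓ) (B : RawTheory (S ∪∅) c ℓ) where

  RestrictionsAgree : Set (i ⊔ v ⊔ suc (c ⊔ ℓ))
  RestrictionsAgree = restrict {S = S ∪∅} just B ≡ restrict {S = S} value A

  IsModificationOf : Set (i ⊔ v ⊔ suc (c ⊔ ℓ))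
  IsModificationOf = IsQuantifierTheory em B × RestrictionsAgree

  IsModelOf : Set (i ⊔ v ⊔ suc (c ⊔ ℓ))
  IsModelOf = IsQuantifierModel em B (∅ᵐ S) × RestrictionsAgree

-- The modification A[Z]: every member X of S ∪ {∅} is read in A as itself if
-- X is nonempty, and as Z if X = ∅.

module _ {i v c ℓ} {S : Collection i v} (A : RawTheory S c ℓ) (Z : Index S) where
  open RawTheory A

  private
    at : Index (S ∪∅) → Index S
    at = maybe value Z

  modification : RawTheory (S ∪∅) c ℓ
  modification = record
    { Form    = Form ∘ at
    ; Term    = Term ∘ at
    ; ε       = λ { {just _} → ε ; {nothing} () }
    ; subForm = λ { {just _} → subForm ; {nothing} x₀ → ⊥-elim-irr (lower x₀) }
    ; subTerm = λ { {just _} → subTerm ; {nothing} x₀ → ⊥-elim-irr (lower x₀) }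
    ; All     = λ { {just _} → All ; {nothing} () }
    }

{-# OPTIONS --safe #-}

-- Only finitely many variables matter to an element of A(X), so on them X
-- embeds into the infinite set Z, with a left inverse; hence substitutions
-- into A*(Z) separate the elements of A(X), and a formula that is constant
-- under them is closed.  For the infimum condition M2, some y ∈ Z is fresh for
-- everything in sight, so that (∀x.p)σ = ∀y.(pσ^{y/x}).  Instantiating y by d
-- shows that this is a lower bound of the pσ^{d/x}; and a lower bound q for
-- which y is fresh satisfies q = ∀y.q ≤ ∀y.(pσ^{y/x}).

module Submission where

open import Defs
open import Algebra.Lattice.Bundles using (BooleanAlgebra)
open import Algebra.Lattice.Morphism.Structures using (IsLatticeHomomorphism)
import Algebra.Lattice.Properties.BooleanAlgebra as BooleanAlgebraProperties
import Algebra.Lattice.Properties.Lattice as LatticeProperties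
open import Data.Empty using (⊥-elim; ⊥-elim-irr)
open import Data.List.Base using (List; []; _∷_; _++_)
open import Data.List.Membership.Propositional renaming (_∈_ to _∈ₗ_; _∉_ to _∉ₗ_)
open import Data.List.Membership.Propositional.Properties using (∈-++⁺ˡ; ∈-++⁺ʳ)
open import Data.List.Relation.Unary.Any using (here; there)
open import Data.Maybe.Base using (Maybe; just; nothing; maybe)
open import Data.Product.Base using (∃; _×_; _,_; proj₁; proj₂)
open import Data.Refinement.Base using (value) renaming (_,_ to _,ʳ_)
open import Data.Irrelevant using () renaming ([_] to irr)
open import Function.Base using (_∘_)
open import Function.Bundles using (mk⇔)
open import Level using (lower; _⊔_)
open import Relation.Binary.Bundles using (Poset; Setoid)
open import Relation.Binary.PropositionalEquality
  using (_≡_; _≢_; refl; sym; trans; cong)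
open import Relation.Nullary using (¬_; yes; no)
open import Relation.Nullary.Decidable using (decidable-stable)

-- Finite lists inside infinite sets

module _ (em : Classical) where

  -- Without such a `y`, excluded middle puts every element in `xs`, which then enumerates `A`.
  fresh : ∀ {a} {A : Set a} → Infinite A → (xs : List A) → ∃ λ y → y ∉ₗ xs
  fresh {A = A} inf xs with em {P = ∃ λ y → y ∉ₗ xs}
  ... | yes found = found
  ... | no  none  = ⊥-elim (inf (xs ,
    (λ {y} _ → decidable-stable em (λ y∉ → none (y , y∉))) , λ _ → _))

  -- By `from-to`, `to` is injective on `xs`; elsewhere its values are arbitrary. `range` bounds
  -- where `from` is defined, so points with `from y ≡ nothing` can be found by `fresh`.
  record PartialEmbedding {a b} {A : Set a} {B : Set b} (xs : List A) : Set (a ⊔ b) where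
    field
      to        : A → B
      from      : B → Maybe A
      from-to   : ∀ {x} → x ∈ₗ xs → from (to x) ≡ just x
      range     : List B
      off-range : ∀ {y} → y ∉ₗ range → from y ≡ nothing

  embed : ∀ {a b} {A : Set a} {B : Set b} → Infinite B → (xs : List A) →
    PartialEmbedding {A = A} {B = B} xs
  embed inf [] = record
    { to = λ _ → proj₁ (fresh inf []) ; from = λ _ → nothing
    ; from-to = λ () ; range = [] ; off-range = λ _ → refl }
  embed {A = A} {B} inf (x ∷ xs) = record
    { to = to′ ; from = from′ ; from-to = from-to′
    ; range = y ∷ range ; off-range = off-range′ }
    where
    -- The head goes to a point outside the old range. A repeated `x` is harmless: its former image
    -- still returns to `x`.
    open PartialEmbedding (embed {B = B} inf xs)
    y : B
    y = proj₁ (fresh inf range)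
    y∉ : y ∉ₗ range
    y∉ = proj₂ (fresh inf range)
    to′ : A → B
    to′ u with em {P = u ≡ x}
    ... | yes _ = y
    ... | no  _ = to u
    from′ : B → Maybe A
    from′ v with em {P = v ≡ y}
    ... | yes _ = just x
    ... | no  _ = from v
    from-to′ : ∀ {u} → u ∈ₗ x ∷ xs → from′ (to′ u) ≡ just u
    from-to′ {u} u∈ with em {P = u ≡ x}
    from-to′ {u} u∈ | yes refl with em {P = y ≡ y}
    ... | yes _ = refl
    ... | no y≢y = ⊥-elim (y≢y refl)
    from-to′ {u} (here u≡x) | no u≢x = ⊥-elim (u≢x u≡x)
    from-to′ {u} (there u∈) | no u≢x with em {P = to u ≡ y}
    ... | no _ = from-to u∈
    ... | yes tu≡y with trans (sym (from-to u∈)) (trans (cong from tu≡y) (off-range y∉))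
    ... | ()
    off-range′ : ∀ {v} → v ∉ₗ y ∷ range → from′ v ≡ nothing
    off-range′ {v} v∉ with em {P = v ≡ y}
    ... | yes v≡y = ⊥-elim (v∉ (here v≡y))
    ... | no  _   = off-range (v∉ ∘ there)

  retract : ∀ {a} {A : Set a} (x : A) (xs : List A) →
    ∃ λ (r : A → A) → (∀ u → r u ∈ₗ x ∷ xs) × (∀ {u} → u ∈ₗ xs → r u ≡ u)
  retract {A = A} x xs = r , r∈ , r-id
    where
    r : A → A
    r u with em {P = u ∈ₗ xs}
    ... | yes _ = u
    ... | no  _ = x
    r∈ : ∀ u → r u ∈ₗ x ∷ xs
    r∈ u with em {P = u ∈ₗ xs}
    ... | yes u∈ = there u∈
    ... | no  _  = here refl
    r-id : ∀ {u} → u ∈ₗ xs → r u ≡ u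
    r-id {u} u∈ with em {P = u ∈ₗ xs}
    ... | yes _  = refl
    ... | no  u∉ = ⊥-elim (u∉ u∈)

  -- Overridden substitutions

  module Override {i v c ℓ} {S : Collection i v} (A : RawTheory S c ℓ) where
    open RawTheory A

    override-same : ∀ {X Y} (σ : Subst X Y) (d : Tm Y) (x : Var S X) →
      override em A {X} {Y} σ d x x ≡ d
    override-same σ d x with em {P = x ≡ x}
    ... | yes _  = refl
    ... | no x≢x = ⊥-elim (x≢x refl)

    override-other : ∀ {X Y} (σ : Subst X Y) (d : Tm Y) {x u : Var S X} → u ≢ x →
      override em A {X} {Y} σ d x u ≡ σ u
    override-other σ d {x} {u} u≢x with em {P = u ≡ x}
    ... | yes u≡x = ⊥-elim (u≢x u≡x)
    ... | no  _   = refl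

    override-cong : ∀ {X Y} (σ τ : Subst X Y) (d : Tm Y) (x u : Var S X) →
      σ u ≈[ term , Y ] τ u →
      override em A {X} {Y} σ d x u ≈[ term , Y ] override em A {X} {Y} τ d x u
    override-cong {Y = Y} σ τ d x u σ≈τ with em {P = u ≡ x}
    ... | yes _ = Setoid.refl (Term Y)
    ... | no  _ = σ≈τ

  -- Finite supports and renaming into `Z`

  module LocallyFiniteTheory {i v c ℓ} {S : Collection i v} {A : RawTheory S c ℓ}
    (isTheory : IsQuantifierTheory em A) (locallyFinite : RawTheory.LocallyFinite A)
    (Z : Index S) (Z-infinite : Infinite (Var S Z)) where
    open RawTheory A
    open IsQuantifierTheory isTheory
    open Override A

    ≡⇒≈ : ∀ s X {t u : ∣ s ∣ X} → t ≡ u → t ≈[ s , X ] u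
    ≡⇒≈ s X refl = Setoid.refl (Elem s X)

    z₀ : Var S Z
    z₀ = proj₁ (fresh Z-infinite [])

    finiteSupport : ∀ s {X} (t : ∣ s ∣ X) → ∃ λ xs → IsSupport s {X} (_∈ₗ xs) t
    finiteSupport s {X} t with locallyFinite s {X} t
    ... | V , (xs , V⊆xs , _) , supp =
      xs , λ x₀ σ τ σ≈τ → supp x₀ σ τ (λ x∈ → σ≈τ (V⊆xs x∈))

    sub-sub : ∀ s {X Y W} .(x₀ : Var S X) .(y₀ : Var S Y) (t : ∣ s ∣ X) {xs : List (Var S X)} →
      IsSupport s {X} (_∈ₗ xs) t → (σ : Subst X Y) (τ : Subst Y W) (ρ : Subst X W) →
      (∀ {x} → x ∈ₗ xs → subTerm y₀ (σ x) τ ≈[ term , W ] ρ x) →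
      sub s {Y} {W} y₀ (sub s {X} {Y} x₀ t σ) τ ≈[ s , W ] sub s {X} {W} x₀ t ρ
    sub-sub s {X} {Y} {W} x₀ y₀ t supp σ τ ρ eq = Setoid.trans (Elem s W)
      (P2 s {X} {Y} {W} x₀ y₀ t σ τ) (supp x₀ (comp {X} {Y} {W} y₀ σ τ) ρ eq)

    -- Renaming by an embedding is undone by any substitution that extends its
    -- left inverse.
    module Renaming {X} (xs : List (Var S X)) where
      open PartialEmbedding (embed {B = Var S Z} Z-infinite xs) public

      rename : Subst X Z
      rename x = ε (to x)

      unname : ∀ {W} → Tm W → Subst X W → Subst Z W
      unname d σ z = maybe σ d (from z)

      unname-rename : ∀ {W} (d : Tm W) (σ : Subst X W) {x} → x ∈ₗ xs →
        subTerm z₀ (rename x) (unname {W} d σ) ≈[ term , W ] σ x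
      unname-rename {W} d σ {x} x∈ = Setoid.trans (Term W)
        (P3 (to x) (unname {W} d σ)) (≡⇒≈ term W (cong (maybe σ d) (from-to x∈)))

      unused : Var S Z
      unused = proj₁ (fresh Z-infinite range)

      unname-unused : ∀ {W} (d : Tm W) (σ : Subst X W) →
        subTerm z₀ (ε unused) (unname {W} d σ) ≈[ term , W ] d
      unname-unused {W} d σ = Setoid.trans (Term W) (P3 unused (unname {W} d σ))
        (≡⇒≈ term W (cong (maybe σ d) (off-range (proj₂ (fresh Z-infinite range)))))

    -- Separation, closedness and nontriviality

    inhabitant : ∀ X → .(Var S X) → Var S X
    inhabitant X x₀ with em {P = Var S X}
    ... | yes x = x
    ... | no ¬x = ⊥-elim-irr (¬x x₀)

    -- One renaming on the union of both supports makes the two elements comparable in `A(Z)`;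
    -- undoing it recovers each of them.
    separated : ∀ s {X} .(x₀ : Var S X) (t u : ∣ s ∣ X) →
      (∀ (σ : Subst X Z) → sub s {X} {Z} x₀ t σ ≈[ s , Z ] sub s {X} {Z} x₀ u σ) →
      t ≈[ s , X ] u
    separated s {X} x₀ t u eq = begin
      t                                    ≈⟨ recover t ts-supp ⟨
      sub s z₀ (sub s x₀ t rename) back    ≈⟨ sub-cong s {Z} {X} z₀ (eq rename) (λ _ → Setoid.refl (Term X)) ⟩
      sub s z₀ (sub s x₀ u rename) back    ≈⟨ recover u us-supp ⟩
      u                                    ∎
      where
      open import Relation.Binary.Reasoning.Setoid (Elem s X)
      ts us : List (Var S X)
      ts = proj₁ (finiteSupport s t)
      us = proj₁ (finiteSupport s u)
      open Renaming {X} (ts ++ us)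
      back : Subst Z X
      -- The default must be a relevant term, hence `inhabitant`; which one is immaterial.
      back = unname {X} (ε (inhabitant X x₀)) ε
      ts-supp : IsSupport s {X} (_∈ₗ ts ++ us) t
      ts-supp y₀ σ τ h = proj₂ (finiteSupport s t) y₀ σ τ (λ x∈ → h (∈-++⁺ˡ x∈))
      us-supp : IsSupport s {X} (_∈ₗ ts ++ us) u
      us-supp y₀ σ τ h = proj₂ (finiteSupport s u) y₀ σ τ (λ x∈ → h (∈-++⁺ʳ ts x∈))
      recover : (w : ∣ s ∣ X) → IsSupport s {X} (_∈ₗ ts ++ us) w →
        sub s {Z} {X} z₀ (sub s {X} {Z} x₀ w rename) back ≈[ s , X ] w
      recover w supp = Setoid.trans (Elem s X)
        (sub-sub s x₀ z₀ w supp rename back ε (unname-rename {X} _ ε)) (P1 s x₀ w)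

    constant⇒closed : ∀ s {X} (x₀ : Var S X) (t : ∣ s ∣ X) →
      (∀ (σ τ : Subst X Z) → sub s {X} {Z} x₀ t σ ≈[ s , Z ] sub s {X} {Z} x₀ t τ) →
      Closed s {X} t
    constant⇒closed s {X} x₀ t const {Y} _ σ τ _ =
      Setoid.trans (Elem s Y) (collapse σ) (Setoid.sym (Elem s Y) (collapse τ))
      where
      open import Relation.Binary.Reasoning.Setoid (Elem s Y)
      ts : List (Var S X)
      ts = proj₁ (finiteSupport s t)
      supp : IsSupport s {X} (_∈ₗ ts) t
      supp = proj₂ (finiteSupport s t)
      open Renaming {X} ts
      d : Tm Y
      -- The same `d` serves `σ` and `τ`, so both collapse to one element.
      d = σ x₀
      collapse : (ρ : Subst X Y) →
        sub s {X} {Y} x₀ t ρ ≈[ s , Y ] sub s {X} {Y} x₀ t (λ _ → d)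
      collapse ρ = begin
        sub s x₀ t ρ
          ≈⟨ sub-sub s x₀ z₀ t supp rename (unname {Y} d ρ) ρ (unname-rename {Y} d ρ) ⟨
        sub s z₀ (sub s x₀ t rename) (unname {Y} d ρ)
          ≈⟨ sub-cong s {Z} {Y} z₀ (const rename (λ _ → ε unused)) (λ _ → Setoid.refl (Term Y)) ⟩
        sub s z₀ (sub s x₀ t (λ _ → ε unused)) (unname {Y} d ρ)
          ≈⟨ sub-sub s x₀ z₀ t supp (λ _ → ε unused) (unname {Y} d ρ) (λ _ → d)
               (λ _ → unname-unused {Y} d ρ) ⟩
        sub s x₀ t (λ _ → d) ∎

    -- If `𝟘 ≈ 𝟙`, all formulas over `Z` coincide, so every formula is constant under substitutions
    -- into `Z`, hence closed, against nontriviality.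
    ⊥≉⊤ : ¬ (BooleanAlgebra.⊥ (Form Z) ≈[ form , Z ] BooleanAlgebra.⊤ (Form Z))
    ⊥≉⊤ ⊥≈⊤ with nontrivial
    ... | X , x₀ , p , p-open = p-open (constant⇒closed form {X} x₀ p
      (λ σ τ → ≈-trans (≈⊥ _) (≈-sym (≈⊥ _))))
      where
      open BooleanAlgebra (Form Z) using (_≈_; ∧-congˡ) renaming (trans to ≈-trans; sym to ≈-sym; ⊥ to 𝟘)
      open BooleanAlgebraProperties (Form Z) using (∧-identityʳ; ∧-zeroʳ)
      ≈⊥ : ∀ q → q ≈ 𝟘
      ≈⊥ q = ≈-trans (≈-sym (∧-identityʳ q)) (≈-trans (∧-congˡ (≈-sym ⊥≈⊤)) (∧-zeroʳ q))

    -- Monotonicity and fresh variables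

    subForm-mono : ∀ {X Y} .(x₀ : Var S X) (σ : Subst X Y) {p q : Fm X} →
      LessEq (Form X) p q → LessEq (Form Y) (subForm x₀ p σ) (subForm x₀ q σ)
    subForm-mono {X} {Y} x₀ σ {p} {q} p≤q = Setoid.trans (Elem form Y)
      (⟦⟧-cong p≤q) (∧-homo p q)
      where open IsLatticeHomomorphism
              (IsBooleanHomomorphism.isLatticeHomomorphism (P4 {X} {Y} x₀ σ))

    All-mono : ∀ {X} (x : Var S X) {p q : Fm X} →
      LessEq (Form X) p q → LessEq (Form X) (All x p) (All x q)
    All-mono {X} x {p} {q} p≤q = Setoid.trans (Elem form X) (All-cong x p≤q) (Q1 x p q)

    -- Invariance under all `d`, not just one variable `z` as in P5 and Q3, because `y` is later
    -- instantiated by arbitrary terms.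
    Fresh : ∀ s {X} → Var S X → ∣ s ∣ X → Set _
    Fresh s {X} y t = ∀ d → sub s {X} {X} y t ([_/_] em A {X} d y) ≈[ s , X ] t

    off-support⇒fresh : ∀ s {X} (t : ∣ s ∣ X) {xs : List (Var S X)} →
      IsSupport s {X} (_∈ₗ xs) t → ∀ {y} → y ∉ₗ xs → Fresh s y t
    off-support⇒fresh s {X} t supp {y} y∉ d = Setoid.trans (Elem s X)
      (supp y ([_/_] em A {X} d y) ε (λ {x} x∈ → ≡⇒≈ term X
        (override-other {X} {X} ε d λ { refl → y∉ x∈ })))
      (P1 s y t)

    -- The exceptions are the union of the finite supports of the values of `σ` on `xs`.
    cofinitely-fresh : ∀ {X Y} (σ : Subst X Y) (xs : List (Var S X)) →
      ∃ λ ys → ∀ {y} → y ∉ₗ ys → ∀ {x} → x ∈ₗ xs → Fresh term {Y} y (σ x)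
    cofinitely-fresh σ [] = [] , λ _ ()
    cofinitely-fresh {X} {Y} σ (x ∷ xs) with finiteSupport term {Y} (σ x) | cofinitely-fresh {X} {Y} σ xs
    ... | vs , supp | ys , h = vs ++ ys , λ
      { y∉ (here refl) → off-support⇒fresh term (σ x) supp (y∉ ∘ ∈-++⁺ˡ)
      ; y∉ (there x∈)  → h (y∉ ∘ ∈-++⁺ʳ vs) x∈ }

    -- The formula `q` is `(∀x.p)σ` itself for the lower bound, and a competing lower bound for
    -- maximality.
    record FreshInstance {X} (x : Var S X) (p : Fm X) (σ : Subst X Z) (q : Fm Z) : Set (v ⊔ c ⊔ ℓ) where
      field
        y           : Var S Z
        fresh-q     : Fresh form {Z} y q
        All-rename  : subForm x (All x p) σ ≈[ form , Z ] All y (subForm x p (override em A {X} {Z} σ (ε y) x))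
        instantiate : ∀ d → subForm y (subForm x p (override em A {X} {Z} σ (ε y) x)) ([_/_] em A {Z} d y)
                        ≈[ form , Z ] subForm x p (override em A {X} {Z} σ d x)

    -- P5 needs y fresh for all values of σ, which may fail for every y ∈ Z if
    -- X is infinite; so σ is first replaced by σ ∘ r with r of finite range,
    -- which agrees with σ on the supports of p and ∀x.p.
    freshInstance : ∀ {X} (x : Var S X) (p : Fm X) (σ : Subst X Z) (q : Fm Z) →
      FreshInstance x p σ q
    freshInstance {X} x p σ q = record
      { y = y
      ; fresh-q = off-support⇒fresh form q (proj₂ (finiteSupport form q)) (y∉ ∘ ∈-++⁺ˡ)
      ; All-rename = begin
          subForm x (All x p) σ
            ≈⟨ proj₂ (finiteSupport form (All x p)) x σ′ σ (λ u∈ → σ′≈σ (∈-++⁺ʳ ps u∈)) ⟨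
          subForm x (All x p) σ′
            -- Every value of `σ′` is a value of `σ` on the finite list, for which `y` is fresh.
            ≈⟨ P5 x p σ′ y z (λ y≡z → z∉ (here (sym y≡z))) (λ u → y-fresh (r∈ u) (ε z)) ⟩
          All y (subForm x p (override em A {X} {Z} σ′ (ε y) x))
            ≈⟨ All-cong y (p-supp x _ _ (λ {u} u∈ →
                 override-cong {X} {Z} σ′ σ (ε y) x u (σ′≈σ (∈-++⁺ˡ u∈)))) ⟩
          All y (subForm x p (override em A {X} {Z} σ (ε y) x)) ∎
      ; instantiate = λ d → sub-sub form x y p p-supp _ _ _ (pointwise d)
      }
      where
      open import Relation.Binary.Reasoning.Setoid (Elem form Z)
      ps as : List (Var S X)
      ps = proj₁ (finiteSupport form p)
      as = proj₁ (finiteSupport form (All x p))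
      p-supp : IsSupport form {X} (_∈ₗ ps) p
      p-supp = proj₂ (finiteSupport form p)
      r : Var S X → Var S X
      r = proj₁ (retract x (ps ++ as))
      r∈ : ∀ u → r u ∈ₗ x ∷ ps ++ as
      r∈ = proj₁ (proj₂ (retract x (ps ++ as)))
      σ′ : Subst X Z
      σ′ u = σ (r u)
      σ′≈σ : ∀ {u} → u ∈ₗ ps ++ as → σ′ u ≈[ term , Z ] σ u
      σ′≈σ u∈ = ≡⇒≈ term Z (cong σ (proj₂ (proj₂ (retract x (ps ++ as))) u∈))
      qs ys : List (Var S Z)
      qs = proj₁ (finiteSupport form q)
      -- `x` is listed too, since `r` sends everything outside `ps ++ as` to it.
      ys = proj₁ (cofinitely-fresh {X} {Z} σ (x ∷ ps ++ as))
      y z : Var S Z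
      y = proj₁ (fresh Z-infinite (qs ++ ys))
      z = proj₁ (fresh Z-infinite (y ∷ []))
      y∉ : y ∉ₗ qs ++ ys
      y∉ = proj₂ (fresh Z-infinite (qs ++ ys))
      z∉ : z ∉ₗ y ∷ []
      z∉ = proj₂ (fresh Z-infinite (y ∷ []))
      y-fresh : ∀ {u} → u ∈ₗ x ∷ ps ++ as → Fresh term {Z} y (σ u)
      y-fresh = proj₂ (cofinitely-fresh {X} {Z} σ (x ∷ ps ++ as)) (y∉ ∘ ∈-++⁺ʳ qs)
      pointwise : ∀ d {u} → u ∈ₗ ps →
        subTerm y (override em A {X} {Z} σ (ε y) x u) ([_/_] em A {Z} d y)
          ≈[ term , Z ] override em A {X} {Z} σ d x u
      pointwise d {u} u∈ with em {P = u ≡ x}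
      ... | yes _ = Setoid.trans (Term Z) (P3 y ([_/_] em A {Z} d y))
                      (≡⇒≈ term Z (override-same {Z} {Z} ε d y))
      ... | no  _ = y-fresh (there (∈-++⁺ˡ u∈)) d

    -- Quantification as an infimum

    All-isInfimum : ∀ {X} (x : Var S X) (p : Fm X) (σ : Subst X Z) →
      IsInfimum (Form Z) (λ (d : Tm Z) → subForm x p (override em A {X} {Z} σ d x))
        (subForm x (All x p) σ)
    All-isInfimum {X} x p σ = lower-bound , greatest
      where
      open Poset (LatticeProperties.poset (BooleanAlgebra.lattice (Form Z)))
        using (_≤_; ≤-respʳ-≈; ≤-respˡ-≈) renaming (module Eq to ≈)
      lower-bound : ∀ d → subForm x (All x p) σ ≤ subForm x p (override em A {X} {Z} σ d x)
      -- Q2 gives `∀y.(pσ^{y/x}) ≤ pσ^{y/x}`; applying `[d/y]` fixes the left side by freshness.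
      lower-bound d = ≤-respˡ-≈ (fresh-q d) (≤-respʳ-≈ (instantiate d)
        (subForm-mono y ([_/_] em A {Z} d y) (≤-respˡ-≈ (≈.sym All-rename) (Q2 y _))))
        where open FreshInstance (freshInstance x p σ (subForm x (All x p) σ))
      greatest : ∀ q → (∀ d → q ≤ subForm x p (override em A {X} {Z} σ d x)) →
        q ≤ subForm x (All x p) σ
      greatest q q≤ = ≤-respˡ-≈
        (Q3 y q z (λ z≡y → z∉ (here z≡y)) (fresh-q (ε z)))
        -- The bound is used at the single term `ε y`.
        (≤-respʳ-≈ (≈.sym All-rename) (All-mono y (q≤ (ε y))))
        where
        open FreshInstance (freshInstance x p σ q)
        z : Var S Z
        z = proj₁ (fresh Z-infinite (y ∷ []))
        z∉ : z ∉ₗ y ∷ []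
        z∉ = proj₂ (fresh Z-infinite (y ∷ []))

    -- The modification `A[Z]`

    B : RawTheory (S ∪∅) c ℓ
    B = modification A Z

    private
      module B = RawTheory B

    at : Index (S ∪∅) → Index S
    at = maybe value Z

    member : ∀ {X} → Var S X → Index (S ∪∅)
    member {X} x = just (X ,ʳ irr x)

    -- The two overrides are different functions by cases, hence not
    -- definitionally equal.
    override-modification : ∀ {X} Y (σ : Subst (value X) (at Y)) d x u →
      override em B {just X} {Y} σ d x u ≡ override em A {value X} {at Y} σ d x u
    override-modification Y σ d x u with em {P = u ≡ x}
    ... | yes _ = refl
    ... | no  _ = refl

    sub-override : ∀ {X} Y (p : Fm (value X)) (σ : Subst (value X) (at Y)) d (x : Var S (value X)) →
      subForm {value X} {at Y} x p (override em B {just X} {Y} σ d x)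
        ≈[ form , at Y ] subForm x p (override em A {value X} {at Y} σ d x)
    sub-override {X} Y p σ d x = sub-cong form {value X} {at Y} x (Setoid.refl (Elem form (value X)))
      (λ u → ≡⇒≈ term (at Y) (override-modification {X} Y σ d x u))

    -- Closedness in `B` is tested at the target `nothing`, which is `Z`; this already gives
    -- closedness in `A`.
    closed-modification : ∀ {X} (x₀ : Var S X) (p : Fm X) →
      RawTheory.Closed B form {member x₀} p → Closed form {X} p
    closed-modification {X} x₀ p closed = constant⇒closed form x₀ p
      (λ σ τ → closed {nothing} x₀ σ τ (λ ()))

    modification-isQuantifierTheory : IsQuantifierTheory em B
    modification-isQuantifierTheory = record
      { infinite   = member z₀ , Z-infinite
      ; nontrivial = nontrivial′
      ; sub-cong   = λ
          { form {just X} {Y} → sub-cong form {value X} {at Y}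
          ; term {just X} {Y} → sub-cong term {value X} {at Y}
          -- No substitution has the empty set as its source, so this case is vacuous, here and
          -- below.
          ; _ {nothing} x₀ → ⊥-elim-irr (lower x₀) }
      ; All-cong   = λ { {just X} → All-cong {value X} ; {nothing} () }
      ; P1 = λ
          { form {just X} → P1 form {value X}
          ; term {just X} → P1 term {value X}
          ; _ {nothing} x₀ → ⊥-elim-irr (lower x₀) }
      ; P2 = λ
          { form {just X} {just Y} {W} → P2 form {value X} {value Y} {at W}
          ; term {just X} {just Y} {W} → P2 term {value X} {value Y} {at W}
          ; _ {nothing} x₀ → ⊥-elim-irr (lower x₀)
          ; _ {just _} {nothing} _ y₀ → ⊥-elim-irr (lower y₀) }
      ; P3 = λ { {just X} {Y} → P3 {value X} {at Y} ; {nothing} () }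
      ; P4 = λ { {just X} {Y} → P4 {value X} {at Y} ; {nothing} x₀ → ⊥-elim-irr (lower x₀) }
      ; P5 = λ
          { {just X} {just Y} → P5′ {X} {Y}
          ; {nothing} ()
          ; {just _} {nothing} _ _ _ () }
      ; Q1 = λ { {just X} → Q1 {value X} ; {nothing} () }
      ; Q2 = λ { {just X} → Q2 {value X} ; {nothing} () }
      ; Q3 = λ { {just X} → Q3′ {X} ; {nothing} () }
      }
      where
      nontrivial′ : ∃ λ X → Var (S ∪∅) X × ∃ λ (p : B.Fm X) → ¬ B.Closed form {X} p
      nontrivial′ with nontrivial
      ... | X , x₀ , p , p-open = member x₀ , x₀ , p , p-open ∘ closed-modification x₀ p
      -- P5 of `A`, with the override of `B` exchanged for that of `A` in both hypothesis and
      -- conclusion.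
      P5′ : ∀ {X Y} (x : Var S (value X)) (p : Fm (value X)) (σ : Subst (value X) (value Y))
        (y z : Var S (value Y)) → y ≢ z →
        B._≋_ {just X} {just Y} (B.comp {just X} {just Y} {just Y} y σ ([_/_] em B {just Y} (ε z) y)) σ →
        subForm x (All x p) σ ≈[ form , value Y ]
          All y (subForm x p (override em B {just X} {just Y} σ (ε y) x))
      P5′ {X} {Y} x p σ y z y≢z y-fresh = Setoid.trans (Elem form (value Y))
        (P5 x p σ y z y≢z λ u → Setoid.trans (Term (value Y))
          (sub-cong term {value Y} {value Y} y (Setoid.refl (Term (value Y)))
            (λ w → Setoid.sym (Term (value Y))
              (≡⇒≈ term (value Y) (override-modification {Y} (just Y) ε (ε z) y w))))
          (y-fresh u))
        (All-cong y (Setoid.sym (Elem form (value Y)) (sub-override {X} (just Y) p σ (ε y) x)))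
      Q3′ : ∀ {X} (x : Var S (value X)) (p : Fm (value X)) (y : Var S (value X)) → y ≢ x →
        subForm x p ([_/_] em B {just X} (ε y) x) ≈[ form , value X ] p →
        All x p ≈[ form , value X ] p
      Q3′ {X} x p y y≢x eq = Q3 x p y y≢x (Setoid.trans (Elem form (value X))
        (Setoid.sym (Elem form (value X)) (sub-override {X} (just X) p ε (ε y) x)) eq)

    modification-isQuantifierModel : IsQuantifierModel em B (∅ᵐ S)
    modification-isQuantifierModel = record
      { isQuantifierTheory = modification-isQuantifierTheory
      ; M1-term = ε z₀
      ; M1-form = ⊥≉⊤
      ; M2 = λ { {just X} → M2 {X} ; {nothing} () }
      }
      where
      open Poset (LatticeProperties.poset (BooleanAlgebra.lattice (Form Z)))
        using (≤-respʳ-≈) renaming (module Eq to ≈)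
      M2 : ∀ {X} (x : Var S (value X)) (p : Fm (value X)) (σ : Subst (value X) Z) →
        IsInfimum (Form Z) (λ (d : Tm Z) → subForm x p (override em B {just X} {nothing} σ d x))
          (subForm x (All x p) σ)
      M2 {X} x p σ =
        (λ d → ≤-respʳ-≈ (≈.sym (sub-override {X} nothing p σ d x)) (proj₁ (All-isInfimum x p σ) d)) ,
        (λ q q≤ → proj₂ (All-isInfimum x p σ) q
          (λ d → ≤-respʳ-≈ (sub-override {X} nothing p σ d x) (q≤ d)))

    modification-isFaithful : IsFaithful B (∅ᵐ S)
    modification-isFaithful = record
      { inhabited = ε z₀
      ; separates = λ
          { form {just X} x₀ t u → mk⇔
              (λ t≈u σ → sub-cong form {value X} {Z} x₀ t≈u (λ _ → Setoid.refl (Term Z)))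
              (separated form {value X} x₀ t u)
          ; term {just X} x₀ t u → mk⇔
              (λ t≈u σ → sub-cong term {value X} {Z} x₀ t≈u (λ _ → Setoid.refl (Term Z)))
              (separated term {value X} x₀ t u)
          ; _ {nothing} x₀ → ⊥-elim-irr (lower x₀) }
      }

theorem5 : (em : Classical) → ∀ {i v c ℓ} (S : Collection i v) (A : RawTheory S c ℓ) →
    IsQuantifierTheory em A → RawTheory.LocallyFinite A →
    (Z : Index S) → Infinite (Var S Z) →
    IsModificationOf em A (modification A Z) ×
    IsModelOf em A (modification A Z) ×
    IsFaithful (modification A Z) (∅ᵐ S)
theorem5 em S A isTheory locallyFinite Z Z-infinite =
  -- On nonempty members the operations of the modification unfold to those of `A`, so the
  -- restrictions agree by `refl`.
  (modification-isQuantifierTheory , refl) ,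
  (modification-isQuantifierModel , refl) ,
  modification-isFaithful
  where open LocallyFiniteTheory em {A = A} isTheory locallyFinite Z Z-infinite
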